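{- Let $p:\mathcal E\to\mathcal B$ be a fibration where $\mathcal B$ has finite products. Then the functor $\partial_p:\mathrm{Diff}(p)\to\mathcal B$, $X\mapsto|X|$, $f\mapsto|f|$, is a fibration.
   Context: For a fibration $p:\mathcal E\to\mathcal B$ with $\mathcal B$ having finite products, the category $\mathrm{Diff}(p)$ of differential relations in $p$ is defined as follows. Objects are triples $X=(|X|,[X],\delta_X)$ where $|X|,[X]$ are objects of $\mathcal B$ and $\delta_X$ is an object of the fibre $\mathcal E_{|X|\times[X]\times|X|}$. Arrows $f:X\to Y$ are triples $f=(|f|,Df,\bar f)$ where $|f|:|X|\to|Y|$ and $Df:|X|\times[X]\to|Y|\times[Y]$ are arrows in $\mathcal B$ with $\pi_1\circ Df=|f|\circ\pi_1$, and $\bar f:\delta_X\to\delta_Y$ is an arrow of $\mathcal E$ above $Df\times|f|$. Composition and identities are componentwise, with $\mathrm{id}_X=(\mathrm{id}_{|X|},\mathrm{id}_{|X|\times[X]},\mathrm{id}_{\delta_X})$. Fibrations are Grothendieck fibrations. -}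

module Defs where

open import Level using (Level; _⊔_; suc)
open import Data.Product using (∃!; _×_)
open import Relation.Binary.Core using (Rel)
open import Relation.Binary.Structures using (IsEquivalence)
open import Relation.Binary.Bundles using (Setoid)
open import Relation.Binary.PropositionalEquality using (_≡_; refl; subst₂)
import Relation.Binary.Reasoning.Setoid as SetoidReasoning

-- Arrows are compared by the hom-setoid equality _≈_, objects by _≡_.

record Category (o ℓ e : Level) : Set (suc (o ⊔ ℓ ⊔ e)) where
  infix  4 _⇒_ _≈_
  infixr 9 _∘_
  field
    Obj : Set o
    _⇒_ : Rel Obj ℓ
    _≈_ : ∀ {A B} → Rel (A ⇒ B) e
    id  : ∀ {A} → A ⇒ A
    _∘_ : ∀ {A B C} → B ⇒ C → A ⇒ B → A ⇒ C

    isEquivalence : ∀ {A B} → IsEquivalence (_≈_ {A} {B})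
    ∘-resp-≈  : ∀ {A B C} {f f′ : B ⇒ C} {g g′ : A ⇒ B} →
                f ≈ f′ → g ≈ g′ → f ∘ g ≈ f′ ∘ g′
    identityˡ : ∀ {A B} {f : A ⇒ B} → id ∘ f ≈ f
    identityʳ : ∀ {A B} {f : A ⇒ B} → f ∘ id ≈ f
    assoc     : ∀ {A B C D} {f : A ⇒ B} {g : B ⇒ C} {h : C ⇒ D} →
                (h ∘ g) ∘ f ≈ h ∘ (g ∘ f)

  homSetoid : Obj → Obj → Setoid ℓ e
  homSetoid A B = record { Carrier = A ⇒ B ; _≈_ = _≈_ ; isEquivalence = isEquivalence }

  module Equiv {A B : Obj} = IsEquivalence (isEquivalence {A} {B})
  module HomReasoning {A B : Obj} = SetoidReasoning (homSetoid A B)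

record Functor {o ℓ e o′ ℓ′ e′ : Level} (C : Category o ℓ e) (D : Category o′ ℓ′ e′) :
               Set (o ⊔ ℓ ⊔ e ⊔ o′ ⊔ ℓ′ ⊔ e′) where
  private
    module C = Category C
    module D = Category D
  field
    F₀ : C.Obj → D.Obj
    F₁ : ∀ {A B} → A C.⇒ B → F₀ A D.⇒ F₀ B
    F-resp-≈     : ∀ {A B} {f g : A C.⇒ B} → f C.≈ g → F₁ f D.≈ F₁ g
    identity     : ∀ {A} → F₁ (C.id {A}) D.≈ D.id
    homomorphism : ∀ {X Y Z} {f : X C.⇒ Y} {g : Y C.⇒ Z} →
                   F₁ (g C.∘ f) D.≈ F₁ g D.∘ F₁ f

record FiniteProducts {o ℓ e : Level} (C : Category o ℓ e) : Set (o ⊔ ℓ ⊔ e) where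
  open Category C
  infixl 7 _⊗_ _⊗₁_
  field
    ⊤        : Obj
    !        : ∀ {A} → A ⇒ ⊤
    !-unique : ∀ {A} (f : A ⇒ ⊤) → ! ≈ f

    _⊗_      : Obj → Obj → Obj
    π₁       : ∀ {A B} → A ⊗ B ⇒ A
    π₂       : ∀ {A B} → A ⊗ B ⇒ B
    ⟨_,_⟩    : ∀ {A B X} → X ⇒ A → X ⇒ B → X ⇒ A ⊗ B
    project₁ : ∀ {A B X} {f : X ⇒ A} {g : X ⇒ B} → π₁ ∘ ⟨ f , g ⟩ ≈ f
    project₂ : ∀ {A B X} {f : X ⇒ A} {g : X ⇒ B} → π₂ ∘ ⟨ f , g ⟩ ≈ g
    unique   : ∀ {A B X} {f : X ⇒ A} {g : X ⇒ B} {h : X ⇒ A ⊗ B} →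
               π₁ ∘ h ≈ f → π₂ ∘ h ≈ g → ⟨ f , g ⟩ ≈ h

  _⊗₁_ : ∀ {A B A′ B′} → A ⇒ A′ → B ⇒ B′ → A ⊗ B ⇒ A′ ⊗ B′
  f ⊗₁ g = ⟨ f ∘ π₁ , g ∘ π₂ ⟩

  open Equiv using () renaming (refl to ≈-refl; sym to ≈-sym; trans to ≈-trans)

  ⊗₁-resp-≈ : ∀ {A B A′ B′} {f f′ : A ⇒ A′} {g g′ : B ⇒ B′} →
              f ≈ f′ → g ≈ g′ → f ⊗₁ g ≈ f′ ⊗₁ g′
  ⊗₁-resp-≈ p q = unique (≈-trans project₁ (∘-resp-≈ (≈-sym p) ≈-refl))
                         (≈-trans project₂ (∘-resp-≈ (≈-sym q) ≈-refl))

  ⊗₁-id : ∀ {A B} → id {A} ⊗₁ id {B} ≈ id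
  ⊗₁-id = unique (≈-trans identityʳ (≈-sym identityˡ)) (≈-trans identityʳ (≈-sym identityˡ))

  ⊗₁-∘ : ∀ {A B A′ B′ A″ B″} {f : A ⇒ A′} {f′ : A′ ⇒ A″} {g : B ⇒ B′} {g′ : B′ ⇒ B″} →
         (f′ ∘ f) ⊗₁ (g′ ∘ g) ≈ (f′ ⊗₁ g′) ∘ (f ⊗₁ g)
  ⊗₁-∘ {f = f} {f′} {g} {g′} = unique
    (begin
      π₁ ∘ (f′ ⊗₁ g′) ∘ (f ⊗₁ g)   ≈⟨ assoc ⟨
      (π₁ ∘ (f′ ⊗₁ g′)) ∘ (f ⊗₁ g) ≈⟨ ∘-resp-≈ project₁ ≈-refl ⟩
      (f′ ∘ π₁) ∘ (f ⊗₁ g)         ≈⟨ assoc ⟩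
      f′ ∘ π₁ ∘ (f ⊗₁ g)           ≈⟨ ∘-resp-≈ ≈-refl project₁ ⟩
      f′ ∘ f ∘ π₁                  ≈⟨ assoc ⟨
      (f′ ∘ f) ∘ π₁                ∎)
    (begin
      π₂ ∘ (f′ ⊗₁ g′) ∘ (f ⊗₁ g)   ≈⟨ assoc ⟨
      (π₂ ∘ (f′ ⊗₁ g′)) ∘ (f ⊗₁ g) ≈⟨ ∘-resp-≈ project₂ ≈-refl ⟩
      (g′ ∘ π₂) ∘ (f ⊗₁ g)         ≈⟨ assoc ⟩
      g′ ∘ π₂ ∘ (f ⊗₁ g)           ≈⟨ ∘-resp-≈ ≈-refl project₂ ⟩
      g′ ∘ g ∘ π₂                  ≈⟨ assoc ⟨
      (g′ ∘ g) ∘ π₂                ∎)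
    where open HomReasoning

module _ {o ℓ e o′ ℓ′ e′ : Level} {E : Category o ℓ e} {B : Category o′ ℓ′ e′}
         (p : Functor E B) where
  private
    module E = Category E
    module B = Category B
  open Functor p
  open B.Equiv using () renaming (sym to ≈-sym; trans to ≈-trans)

  record FibreObj (I : B.Obj) : Set (o ⊔ o′) where
    constructor fibreObj
    field
      obj  : E.Obj
      over : F₀ obj ≡ I

  open FibreObj

  -- Since F₀ (obj X) and I are only propositionally equal, "f lies above u"
  -- compares u with F₁ f transported along the equalities of its endpoints.
  Above : ∀ {I J} (X : FibreObj I) (Y : FibreObj J) → obj X E.⇒ obj Y → I B.⇒ J → Set e′
  Above X Y f u = subst₂ B._⇒_ (over X) (over Y) (F₁ f) B.≈ u

  above-resp-≈ : ∀ {I J} (X : FibreObj I) (Y : FibreObj J) {f : obj X E.⇒ obj Y} {u v : I B.⇒ J} →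
                 u B.≈ v → Above X Y f u → Above X Y f v
  above-resp-≈ X Y u≈v f↑u = ≈-trans f↑u u≈v

  above-id : ∀ {I} (X : FibreObj I) → Above X X E.id B.id
  above-id (fibreObj _ refl) = identity

  above-∘ : ∀ {I J K} (X : FibreObj I) (Y : FibreObj J) (Z : FibreObj K)
            {f : obj X E.⇒ obj Y} {g : obj Y E.⇒ obj Z} {u : I B.⇒ J} {v : J B.⇒ K} →
            Above Y Z g v → Above X Y f u → Above X Z (g E.∘ f) (v B.∘ u)
  above-∘ (fibreObj _ refl) (fibreObj _ refl) (fibreObj _ refl) g↑v f↑u =
    ≈-trans homomorphism (B.∘-resp-≈ g↑v f↑u)

  IsCartesian : ∀ {X Y} → X E.⇒ Y → Set (o ⊔ ℓ ⊔ e ⊔ ℓ′ ⊔ e′)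
  IsCartesian {X} {Y} f =
    ∀ {Z} (g : Z E.⇒ Y) (w : F₀ Z B.⇒ F₀ X) → F₁ f B.∘ w B.≈ F₁ g →
    ∃! E._≈_ λ (h : Z E.⇒ X) → F₁ h B.≈ w × f E.∘ h E.≈ g

  record CartesianLift {I : B.Obj} (Y : E.Obj) (u : I B.⇒ F₀ Y) :
                       Set (o ⊔ ℓ ⊔ e ⊔ o′ ⊔ ℓ′ ⊔ e′) where
    field
      dom         : FibreObj I
      arr         : obj dom E.⇒ Y
      above       : Above dom (fibreObj Y refl) arr u
      isCartesian : IsCartesian arr

  -- A Grothendieck fibration: the domain of each lift lies over I on the nose
  -- (up to _≡_), not merely up to isomorphism.  No choice of lifts is required to
  -- respect _≈_ of u or to be functorial.
  IsFibration : Set (o ⊔ ℓ ⊔ e ⊔ o′ ⊔ ℓ′ ⊔ e′)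
  IsFibration = ∀ {I} (Y : E.Obj) (u : I B.⇒ F₀ Y) → CartesianLift Y u

module _ {o ℓ e o′ ℓ′ e′ : Level} {E : Category o ℓ e} {B : Category o′ ℓ′ e′}
         (products : FiniteProducts B) (p : Functor E B) where
  private
    module E = Category E
    module B = Category B
  open B using (_∘_; _≈_; ∘-resp-≈)
  open FiniteProducts products
  open FibreObj
  open B.Equiv using () renaming (refl to ≈-refl; sym to ≈-sym; trans to ≈-trans)

  -- The construction uses only the chosen products of B and the notion of lying above,
  -- so it is given for any functor p.
  record DiffObj : Set (o ⊔ o′) where
    field
      ∣_∣ : B.Obj
      [_] : B.Obj
      δ   : FibreObj p (∣_∣ ⊗ [_] ⊗ ∣_∣)

  open DiffObj

  record DiffArr (X Y : DiffObj) : Set (ℓ ⊔ ℓ′ ⊔ e′) where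
    field
      ∣_∣₁     : ∣ X ∣ B.⇒ ∣ Y ∣
      D        : ∣ X ∣ ⊗ [ X ] B.⇒ ∣ Y ∣ ⊗ [ Y ]
      D-π₁     : π₁ ∘ D ≈ ∣_∣₁ ∘ π₁
      bar      : obj (δ X) E.⇒ obj (δ Y)
      barAbove : Above p (δ X) (δ Y) bar (D ⊗₁ ∣_∣₁)

  open DiffArr

  record DiffEq {X Y : DiffObj} (f g : DiffArr X Y) : Set (e ⊔ e′) where
    field
      ∣∣-eq  : ∣ f ∣₁ ≈ ∣ g ∣₁
      D-eq   : D f ≈ D g
      bar-eq : bar f E.≈ bar g

  open DiffEq

  Diff : Category (o ⊔ o′) (ℓ ⊔ ℓ′ ⊔ e′) (e ⊔ e′)
  Diff = record
    { Obj = DiffObj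
    ; _⇒_ = DiffArr
    ; _≈_ = DiffEq
    ; id  = λ {X} → record
      { ∣_∣₁     = B.id
      ; D        = B.id
      ; D-π₁     = ≈-trans B.identityʳ (≈-sym B.identityˡ)
      ; bar      = E.id
      ; barAbove = above-resp-≈ p (δ X) (δ X) (≈-sym ⊗₁-id) (above-id p (δ X))
      }
    ; _∘_ = λ {X} {Y} {Z} g f → record
      { ∣_∣₁     = ∣ g ∣₁ ∘ ∣ f ∣₁
      ; D        = D g ∘ D f
      ; D-π₁     = begin
          π₁ ∘ D g ∘ D f           ≈⟨ B.assoc ⟨
          (π₁ ∘ D g) ∘ D f         ≈⟨ ∘-resp-≈ (D-π₁ g) ≈-refl ⟩
          (∣ g ∣₁ ∘ π₁) ∘ D f      ≈⟨ B.assoc ⟩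
          ∣ g ∣₁ ∘ π₁ ∘ D f        ≈⟨ ∘-resp-≈ ≈-refl (D-π₁ f) ⟩
          ∣ g ∣₁ ∘ ∣ f ∣₁ ∘ π₁     ≈⟨ B.assoc ⟨
          (∣ g ∣₁ ∘ ∣ f ∣₁) ∘ π₁   ∎
      ; bar      = bar g E.∘ bar f
      ; barAbove = above-resp-≈ p (δ X) (δ Z) (≈-sym ⊗₁-∘)
                     (above-∘ p (δ X) (δ Y) (δ Z) (barAbove g) (barAbove f))
      }
    ; isEquivalence = record
      { refl  = record { ∣∣-eq = ≈-refl ; D-eq = ≈-refl ; bar-eq = E.Equiv.refl }
      ; sym   = λ q → record { ∣∣-eq  = ≈-sym (∣∣-eq q)
                             ; D-eq   = ≈-sym (D-eq q)
                             ; bar-eq = E.Equiv.sym (bar-eq q) }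
      ; trans = λ q r → record { ∣∣-eq  = ≈-trans (∣∣-eq q) (∣∣-eq r)
                               ; D-eq   = ≈-trans (D-eq q) (D-eq r)
                               ; bar-eq = E.Equiv.trans (bar-eq q) (bar-eq r) }
      }
    ; ∘-resp-≈  = λ q r → record { ∣∣-eq  = ∘-resp-≈ (∣∣-eq q) (∣∣-eq r)
                                 ; D-eq   = ∘-resp-≈ (D-eq q) (D-eq r)
                                 ; bar-eq = E.∘-resp-≈ (bar-eq q) (bar-eq r) }
    ; identityˡ = record { ∣∣-eq = B.identityˡ ; D-eq = B.identityˡ ; bar-eq = E.identityˡ }
    ; identityʳ = record { ∣∣-eq = B.identityʳ ; D-eq = B.identityʳ ; bar-eq = E.identityʳ }
    ; assoc     = record { ∣∣-eq = B.assoc ; D-eq = B.assoc ; bar-eq = E.assoc }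
    }
    where open B.HomReasoning

  ∂ : Functor Diff B
  ∂ = record
    { F₀           = ∣_∣
    ; F₁           = ∣_∣₁
    ; F-resp-≈     = ∣∣-eq
    ; identity     = ≈-refl
    ; homomorphism = ≈-refl
    }

{-# OPTIONS --safe #-}
-- Over u : I → |Y| take [X] = [Y] and D = u × id.  The square formed by D, u and the
-- projections π₁ is a pullback, so the condition π₁ ∘ Dh = w ∘ π₁ together with
-- D ∘ Dh = Dg determines Dh = ⟨ w ∘ π₁ , π₂ ∘ Dg ⟩.  Taking for δ_X the domain of a
-- p-cartesian lift of D × u at δ_Y, the third component is determined as well.
module Submission where

open import Defs
open import Level using (Level)
open import Data.Product using (Σ-syntax; ∃!; _×_; _,_)
open import Relation.Binary.PropositionalEquality using (refl)

module _ {o ℓ e o′ ℓ′ e′ : Level} {E : Category o ℓ e} {B : Category o′ ℓ′ e′}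
         (p : Functor E B) where
  private
    module E = Category E
    module B = Category B
  open Functor p
  open FibreObj
  open B.Equiv using () renaming (sym to ≈-sym; trans to ≈-trans)

  cartesianLift : IsFibration p → ∀ {I J} (Y : FibreObj p J) (u : I B.⇒ J) →
                  Σ[ X ∈ FibreObj p I ] Σ[ f ∈ obj X E.⇒ obj Y ]
                    Above p X Y f u × IsCartesian p f
  cartesianLift fib (fibreObj Y refl) u = dom , arr , above , isCartesian
    where open CartesianLift (fib Y u)

  cartesian-factor : ∀ {I J K} (X : FibreObj p I) (Y : FibreObj p J) (Z : FibreObj p K)
                     {f : obj X E.⇒ obj Y} {g : obj Z E.⇒ obj Y}
                     {u : I B.⇒ J} {w : K B.⇒ I} →
                     IsCartesian p f → Above p X Y f u → Above p Z Y g (u B.∘ w) →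
                     ∃! E._≈_ λ (h : obj Z E.⇒ obj X) → Above p Z X h w × f E.∘ h E.≈ g
  cartesian-factor (fibreObj _ refl) (fibreObj _ refl) (fibreObj _ refl) cart f↑u g↑uw =
    cart _ _ (≈-trans (B.∘-resp-≈ f↑u B.Equiv.refl) (≈-sym g↑uw))

module _ {o ℓ e : Level} {B : Category o ℓ e} (products : FiniteProducts B) where
  open Category B
  open FiniteProducts products
  open Equiv using () renaming (refl to ≈-refl; sym to ≈-sym; trans to ≈-trans)
  open HomReasoning

  π₂-⊗₁-id : ∀ {A A′ C X} {u : A ⇒ A′} {k : X ⇒ A ⊗ C} → π₂ ∘ (u ⊗₁ id) ∘ k ≈ π₂ ∘ k
  π₂-⊗₁-id {u = u} {k} = begin
    π₂ ∘ (u ⊗₁ id) ∘ k   ≈⟨ assoc ⟨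
    (π₂ ∘ (u ⊗₁ id)) ∘ k ≈⟨ ∘-resp-≈ (≈-trans project₂ identityˡ) ≈-refl ⟩
    π₂ ∘ k               ∎

  ⊗₁-id-factor : ∀ {A A′ C X} {u : A ⇒ A′} {a : X ⇒ A} {d : X ⇒ A′ ⊗ C} →
                 u ∘ a ≈ π₁ ∘ d → (u ⊗₁ id) ∘ ⟨ a , π₂ ∘ d ⟩ ≈ d
  ⊗₁-id-factor {u = u} {a} {d} ua≈π₁d = ≈-trans (≈-sym (unique π₁-eq π₂-eq)) (unique ≈-refl ≈-refl)
    where
    π₁-eq : π₁ ∘ (u ⊗₁ id) ∘ ⟨ a , π₂ ∘ d ⟩ ≈ π₁ ∘ d
    π₁-eq = begin
      π₁ ∘ (u ⊗₁ id) ∘ ⟨ a , π₂ ∘ d ⟩   ≈⟨ assoc ⟨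
      (π₁ ∘ (u ⊗₁ id)) ∘ ⟨ a , π₂ ∘ d ⟩ ≈⟨ ∘-resp-≈ project₁ ≈-refl ⟩
      (u ∘ π₁) ∘ ⟨ a , π₂ ∘ d ⟩         ≈⟨ assoc ⟩
      u ∘ π₁ ∘ ⟨ a , π₂ ∘ d ⟩           ≈⟨ ∘-resp-≈ ≈-refl project₁ ⟩
      u ∘ a                             ≈⟨ ua≈π₁d ⟩
      π₁ ∘ d                            ∎

    π₂-eq : π₂ ∘ (u ⊗₁ id) ∘ ⟨ a , π₂ ∘ d ⟩ ≈ π₂ ∘ d
    π₂-eq = ≈-trans π₂-⊗₁-id project₂

  ⊗₁-id-factor-unique : ∀ {A A′ C X} {u : A ⇒ A′} {a : X ⇒ A} {d : X ⇒ A′ ⊗ C} {k : X ⇒ A ⊗ C} →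
                        π₁ ∘ k ≈ a → (u ⊗₁ id) ∘ k ≈ d → ⟨ a , π₂ ∘ d ⟩ ≈ k
  ⊗₁-id-factor-unique π₁k≈a uk≈d =
    unique π₁k≈a (≈-trans (≈-sym π₂-⊗₁-id) (∘-resp-≈ ≈-refl uk≈d))

proposition4p4 : ∀ {o ℓ e o′ ℓ′ e′ : Level} {E : Category o ℓ e} {B : Category o′ ℓ′ e′}
    (products : FiniteProducts B) (p : Functor E B) →
    IsFibration p → IsFibration (∂ products p)
proposition4p4 {E = E} {B = B} products p fib {I} Y u
  with cartesianLift p fib (DiffObj.δ Y) (FiniteProducts._⊗₁_ products
         (FiniteProducts._⊗₁_ products u (Category.id B)) u)
... | δX , φ , φ-above , φ-cartesian = record
  { dom         = fibreObj X refl
  ; arr         = f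
  ; above       = ≈-refl
  ; isCartesian = λ {Z} → factor {Z}
  }
  where
  module E = Category E
  open Category B
  open FiniteProducts products
  open Equiv using () renaming (refl to ≈-refl; sym to ≈-sym; trans to ≈-trans)
  open HomReasoning
  open DiffObj
  open DiffArr
  open DiffEq

  X : DiffObj products p
  X = record { ∣_∣ = I ; [_] = [ Y ] ; δ = δX }

  f : DiffArr products p X Y
  f = record { ∣_∣₁ = u ; D = u ⊗₁ id ; D-π₁ = project₁ ; bar = φ ; barAbove = φ-above }

  D-factor : ∀ {Z} (g : DiffArr products p Z Y) {w : ∣ Z ∣ ⇒ I} → u ∘ w ≈ ∣ g ∣₁ →
             D f ∘ ⟨ w ∘ π₁ , π₂ ∘ D g ⟩ ≈ D g
  D-factor g {w} uw≈g = ⊗₁-id-factor products (begin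
    u ∘ w ∘ π₁     ≈⟨ assoc ⟨
    (u ∘ w) ∘ π₁   ≈⟨ ∘-resp-≈ uw≈g ≈-refl ⟩
    ∣ g ∣₁ ∘ π₁    ≈⟨ D-π₁ g ⟨
    π₁ ∘ D g       ∎)

  factor : IsCartesian (∂ products p) f
  factor {Z} g w uw≈g
    with cartesian-factor p δX (δ Y) (δ Z) φ-cartesian φ-above
           (above-resp-≈ p (δ Z) (δ Y) (≈-trans (⊗₁-resp-≈ (≈-sym (D-factor g uw≈g)) (≈-sym uw≈g)) ⊗₁-∘)
             (barAbove g))
  ... | ψ , (ψ-above , φψ≈g) , ψ-unique = h , (≈-refl , fh≈g) , h-unique
    where
    h : DiffArr products p Z X
    h = record { ∣_∣₁ = w ; D = ⟨ w ∘ π₁ , π₂ ∘ D g ⟩ ; D-π₁ = project₁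
               ; bar = ψ ; barAbove = ψ-above }

    fh≈g : DiffEq products p (Category._∘_ (Diff products p) f h) g
    fh≈g = record { ∣∣-eq = uw≈g ; D-eq = D-factor g uw≈g ; bar-eq = φψ≈g }

    h-unique : ∀ {k : DiffArr products p Z X} →
               ∣ k ∣₁ ≈ w × DiffEq products p (Category._∘_ (Diff products p) f k) g →
               DiffEq products p h k
    h-unique {k} (k≈w , fk≈g) = record
      { ∣∣-eq  = ≈-sym k≈w
      ; D-eq   = Dh≈Dk
      ; bar-eq = ψ-unique
          ( above-resp-≈ p (δ Z) δX (⊗₁-resp-≈ (≈-sym Dh≈Dk) k≈w) (barAbove k)
          , bar-eq fk≈g )
      }
      where
      Dh≈Dk : ⟨ w ∘ π₁ , π₂ ∘ D g ⟩ ≈ D k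
      Dh≈Dk = ⊗₁-id-factor-unique products
        (≈-trans (D-π₁ k) (∘-resp-≈ k≈w ≈-refl)) (D-eq fk≈g)
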